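{- Let $TS$ be a process satisfying the effectiveness assumptions below and let $k,d\in\mathbb{N}$. Given $s\in S$, it is decidable whether there exist an $S_0$-graph $\theta_0$ whose underlying graph has diameter at most $k$ and maximum degree at most $d$, an $S$-graph $\theta$ with $\theta_0\xrightarrow{*}\theta$ using broadcast steps, and a vertex of $\theta$ whose label $s'$ satisfies $s'\ge s$.
   Context: Fix a finite alphabet $\Sigma$; $\Sigma_b=\{!!a:a\in\Sigma\}$, $\Sigma_r=\{??a:a\in\Sigma\}$. A process is a labelled WSTS $(S,\Sigma_b\cup\Sigma_r,S_0,R,\le)$ with $S_0\subseteq S$ initial configurations and $\le$ a well-quasi-order on $S$ compatible with $R$ (if $s_1\le t_1$ and $(s_1,\lambda,s_2)\in R$ then some $t_2\ge s_2$ has $(t_1,\lambda,t_2)\in R$). Effectiveness assumptions: $TS$ is finitely branching and given by a finite set of labelled rules inducing $R$; $\le$ is decidable; for each label $\lambda$, from a finite basis of an upward-closed $I\subseteq S$ a finite basis of $\{s':(s',\lambda,s)\in R,\ s\in I\}$ is computable; for each rule the finite set of $\le$-minimal configurations enabling it is computable. An $S$-graph is a finite undirected graph $(V,E,L)$ without self-loops with $L:V\to S$. Broadcast step: $(V,E,L)\xrightarrow{a}(V,E,L')$ if there is $v$ with $(L(v),!!a,L'(v))\in R$, $(L(u),??a,L'(u))\in R$ for every neighbour $u$ of $v$, and all other labels unchanged. The topology is static: no reconfiguration of edges is allowed.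
   Formalization: It is additionally assumed decidable, given s, whether some initial configuration in S_0 lies above s; without effective access to S_0 no algorithm uniform in the process exists, since for empty R coverability of s is exactly this question. -}

module Defs where

open import Level using (0ℓ)
open import Data.Nat using (ℕ; zero; suc; _≤_; _<_)
open import Data.Nat.Properties using (n<1+n; m<n⇒m<1+n)
open import Data.Fin using (Fin)
open import Data.Fin.Subset using (Subset; _∈_; _∉_; ∣_∣)
open import Data.List using (List; []; _∷_; applyDownFrom)
open import Data.List.Relation.Unary.Any using (Any; here; there)
open import Data.List.Relation.Unary.All using (All)
import Data.List.Membership.Propositional as List
open import Data.Product using (Σ; ∃; ∃₂; _×_; _,_)
open import Function.Bundles using (_⇔_)
open import Relation.Binary.Core using (Rel)
open import Relation.Binary.Definitions using (Decidable)
open import Relation.Binary.Structures using (IsPreorder)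
open import Relation.Binary.PropositionalEquality using (_≡_; _≢_)
open import Relation.Binary.Construct.Closure.ReflexiveTransitive using (Star)
open import Relation.Nullary using (Dec)
open import Relation.Unary using (Pred)

-- A finite sequence is stored with its newest entry at the head; it is good
-- if some earlier entry is below some later one.
data Good {S : Set} (_≼_ : Rel S 0ℓ) : List S → Set where
  now     : ∀ {x xs} → Any (_≼ x) xs → Good _≼_ (x ∷ xs)
  earlier : ∀ {x xs} → Good _≼_ xs → Good _≼_ (x ∷ xs)

-- Every way of prolonging the given sequence eventually makes it good.
data Barred {S : Set} (_≼_ : Rel S 0ℓ) : List S → Set where
  good   : ∀ {xs} → Good _≼_ xs → Barred _≼_ xs
  extend : ∀ {xs} → (∀ x → Barred _≼_ (x ∷ xs)) → Barred _≼_ xs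

-- The inductive (constructive) form of "there is no infinite bad sequence".
-- It implies the formulation with sequences ℕ → S (goodPair below), and is
-- classically equivalent to it.
record IsWellQuasiOrder {S : Set} (_≼_ : Rel S 0ℓ) : Set where
  field
    isPreorder : IsPreorder _≡_ _≼_
    barred     : Barred _≼_ []

goodPair : ∀ {S : Set} {_≼_ : Rel S 0ℓ} → IsWellQuasiOrder _≼_ →
           (f : ℕ → S) → ∃₂ λ i j → i < j × f i ≼ f j
goodPair {S} {_≼_} wqo f = fromBar 0 (IsWellQuasiOrder.barred wqo)
  where
  fromAny : ∀ {x} n → Any (_≼ x) (applyDownFrom f n) → ∃ λ i → i < n × f i ≼ x
  fromAny (suc n) (here p)  = n , n<1+n n , p
  fromAny (suc n) (there a) with fromAny n a
  ... | i , i<n , p = i , m<n⇒m<1+n i<n , p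

  fromGood : ∀ n → Good _≼_ (applyDownFrom f n) → ∃₂ λ i j → i < j × f i ≼ f j
  fromGood (suc n) (now a) with fromAny n a
  ... | i , i<n , p = i , n , i<n , p
  fromGood (suc n) (earlier g) = fromGood n g

  fromBar : ∀ n → Barred _≼_ (applyDownFrom f n) → ∃₂ λ i j → i < j × f i ≼ f j
  fromBar n (good g)   = fromGood n g
  fromBar n (extend h) = fromBar (suc n) (h (f n))

data Label (A : Set) : Set where
  !!_ ??_ : A → Label A

-- Processes over the alphabet Fin σ.
record Process (σ : ℕ) : Set₁ where
  infix 4 _≼_
  field
    S       : Set
    Initial : Pred S 0ℓ
    R       : S → Label (Fin σ) → S → Set
    _≼_     : Rel S 0ℓ
    isWellQuasiOrder : IsWellQuasiOrder _≼_
    compatible : ∀ {s₁ t₁ l s₂} → s₁ ≼ t₁ → R s₁ l s₂ →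
                 ∃ λ t₂ → s₂ ≼ t₂ × R t₁ l t₂

  ↑ : List S → Pred S 0ℓ
  ↑ B s = Any (_≼ s) B

  IsBasis : List S → Pred S 0ℓ → Set
  IsBasis B I = ∀ s → I s ⇔ ↑ B s

  Pre : Label (Fin σ) → Pred S 0ℓ → Pred S 0ℓ
  Pre l I s′ = ∃ λ s → R s′ l s × I s

  IsMinimal : Pred S 0ℓ → Pred S 0ℓ
  IsMinimal P s = P s × (∀ t → P t → t ≼ s → s ≼ t)

  -- For a quasi-order, "the finite set of minimal elements" is meant up to
  -- the equivalence induced by ≼.
  AreMinimalElements : List S → Pred S 0ℓ → Set
  AreMinimalElements M P = All (IsMinimal P) M × (∀ s → IsMinimal P s → ↑ M s)

record Effective {σ : ℕ} (TS : Process σ) : Set₁ where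
  open Process TS
  field
    finitelyBranching : ∀ s → Σ (List (Label (Fin σ) × S)) λ succs →
                        ∀ l t → R s l t ⇔ (l , t) List.∈ succs

    #rules    : ℕ
    ruleLabel : Fin #rules → Label (Fin σ)
    Fires     : Fin #rules → Rel S 0ℓ
    induced   : ∀ s l t → R s l t ⇔ (∃ λ r → ruleLabel r ≡ l × Fires r s t)

    _≼?_ : Decidable _≼_

    preBasis : ∀ l B → ∃ λ B′ → IsBasis B′ (Pre l (↑ B))

    minimalEnabling : ∀ r → ∃ λ M → AreMinimalElements M (λ s → ∃ (Fires r s))

    -- Effective access to the initial configurations. Some such condition is
    -- needed for an algorithm uniform in the process: when R is empty, this
    -- is exactly what coverability asks.
    initial? : ∀ s → Dec (∃ λ s₀ → Initial s₀ × s ≼ s₀)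

record Graph : Set where
  field
    order       : ℕ
    neighbours  : Fin order → Subset order
    symmetric   : ∀ u v → u ∈ neighbours v → v ∈ neighbours u
    irreflexive : ∀ v → v ∉ neighbours v

  Vertex : Set
  Vertex = Fin order

  degree : Vertex → ℕ
  degree v = ∣ neighbours v ∣

  data Walk : ℕ → Rel Vertex 0ℓ where
    stop : ∀ {v} → Walk 0 v v
    step : ∀ {n u v w} → v ∈ neighbours u → Walk n v w → Walk (suc n) u w

MaxDegree≤ : ℕ → Graph → Set
MaxDegree≤ d G = ∀ v → degree v ≤ d
  where open Graph G

-- All distances are at most k; in particular G is connected.
Diameter≤ : ℕ → Graph → Set
Diameter≤ k G = ∀ u v → ∃ λ n → n ≤ k × Walk n u v
  where open Graph G

module Network {σ : ℕ} (TS : Process σ) where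
  open Process TS

  record SGraph : Set where
    constructor ⟨_,_⟩
    field
      graph : Graph
      label : Graph.Vertex graph → S
    open Graph graph public

  IsInitial : SGraph → Set
  IsInitial θ = ∀ v → Initial (label v)
    where open SGraph θ

  infix 4 _⟶[_]_ _⟶*_

  data _⟶[_]_ : SGraph → Fin σ → SGraph → Set where
    broadcast : ∀ {G : Graph} {L L′ : Graph.Vertex G → S} {a}
      (v : Graph.Vertex G) →
      R (L v) (!! a) (L′ v) →
      (∀ u → u ∈ Graph.neighbours G v → R (L u) (?? a) (L′ u)) →
      (∀ u → u ≢ v → u ∉ Graph.neighbours G v → L′ u ≡ L u) →
      ⟨ G , L ⟩ ⟶[ a ] ⟨ G , L′ ⟩

  _⟶*_ : Rel SGraph 0ℓ
  _⟶*_ = Star λ θ θ′ → ∃ λ a → θ ⟶[ a ] θ′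

  -- Some execution from an initial graph of diameter ≤ k and maximum degree
  -- ≤ d reaches a graph in which some vertex has a label above s.
  Coverable : ℕ → ℕ → S → Set
  Coverable k d s = ∃₂ λ (θ₀ θ : SGraph) →
    IsInitial θ₀ ×
    Diameter≤ k (SGraph.graph θ₀) ×
    MaxDegree≤ d (SGraph.graph θ₀) ×
    θ₀ ⟶* θ ×
    ∃ λ v → s ≼ SGraph.label θ v

{-# OPTIONS --safe #-}
module Submission where

-- By the Moore bound only finitely many graphs have diameter ≤ k and degree ≤ d.
-- On each of them the labellings are ordered pointwise, a well-quasi-order by
-- Dickson's lemma, and backward reachability from the labellings that exhibit a
-- label above s terminates.  The upward-closed sets of labellings are described
-- by constraints that may leave a vertex free.

open import Defs
open import Data.Empty using (⊥)
open import Data.Fin using (Fin; zero; suc)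
open import Data.Fin.Properties using (_≟_; any?; all?; injective⇒≤)
open import Data.Fin.Subset using (Subset; _∈_; _∉_; ∣_∣; inside; outside)
open import Data.Fin.Subset.Properties using (_∈?_; anySubset?)
open import Data.List using (List; []; _∷_; _++_; map; length; concatMap; filter; allFin; lookup; tabulate; cartesianProduct; cartesianProductWith)
open import Data.List.Membership.Propositional using (find; lose) renaming (_∈_ to _∈ˡ_)
open import Data.List.Membership.Propositional.Properties using (∈-allFin; ∈-filter⁺; ∈-filter⁻; ∈-cartesianProduct⁺; ∈-map⁺; ∈-map⁻)
open import Data.List.Properties using (length-++; length-map)
open import Data.List.Relation.Unary.All as All using (All; []; _∷_)
open import Data.List.Relation.Unary.All.Properties using (All¬⇒¬Any; ¬All⇒Any¬)
open import Data.List.Relation.Unary.Any as Any using (Any; here; there)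
import Data.List.Relation.Unary.Any.Properties as Any
open import Data.List.Relation.Unary.Any.Properties using (lookup-index)
open import Data.Maybe using (Maybe; nothing; just)
open import Data.Nat using (ℕ; zero; suc; _*_; _≤_; _<_; z≤n; s≤s; s≤s⁻¹)
open import Data.Nat.Properties using (_≤?_; anyUpTo?; ≤-trans; ≤-reflexive; +-mono-≤; *-monoˡ-≤; module ≤-Reasoning)
open import Data.Product using (∃; ∃₂; _×_; _,_; proj₁; proj₂; map₂)
open import Data.Sum as Sum using (_⊎_; inj₁; inj₂; [_,_]′)
open import Data.Vec using ([]; _∷_; here; there)
import Data.Vec.Functional as F
open import Function using (_∘_; id; _on_)
open import Function.Bundles using (module Equivalence)
open import Level using (0ℓ)
open import Relation.Binary.Construct.Closure.ReflexiveTransitive using (ε; _◅_)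
import Relation.Binary.Construct.Add.Infimum.NonStrict as Infimum
open import Relation.Binary.Core using (Rel; _⇒_)
open import Relation.Binary.Definitions using (Decidable; DecidableEquality; Transitive)
open import Relation.Binary.PropositionalEquality using (_≡_; _≢_; _≗_; refl; sym; trans; cong; subst)
open import Relation.Binary.Structures using (IsPreorder)
open import Relation.Nullary using (¬_; Dec; yes; no; contradiction; _×-dec_; _⊎-dec_; _→-dec_; ¬?)
open import Relation.Nullary.Construct.Add.Infimum using (_₋; ⊥₋; [_])
open import Relation.Nullary.Decidable using (map′; decidable-stable)
open import Relation.Unary using (Pred)
import Relation.Unary as Unary

open Equivalence using (to; from)

private variable
  X Y : Set
  Q T C : Rel X 0ℓ

-- Almost-full relations

-- A well-founded tree of moves: once `x` is drawn, a pair also counts as related when `x` is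
-- related to its first member. Classically, every infinite sequence then has an entry related to a
-- later one. Indexing by the relation, not by the sequence drawn so far as in `Barred`, lets
-- intersections be built by induction on two trees.
data AlmostFull {X : Set} (Q : Rel X 0ℓ) : Set where
  full : (∀ x y → Q x y) → AlmostFull Q
  next : (∀ x → AlmostFull (λ y z → Q y z ⊎ Q x y)) → AlmostFull Q

almostFull-map : Q ⇒ T → AlmostFull Q → AlmostFull T
almostFull-map f (full p) = full λ x y → f (p x y)
almostFull-map f (next p) = next λ x → almostFull-map (Sum.map f f) (p x)

almostFull-on : (f : Y → X) → AlmostFull Q → AlmostFull (Q on f)
almostFull-on f (full p) = full λ x y → p (f x) (f y)
almostFull-on f (next p) = next λ x → almostFull-on f (p (f x))

private
  both : {P W U : Set} → P ⊎ W → P ⊎ U → P ⊎ W × U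
  both (inj₁ p) _        = inj₁ p
  both (inj₂ _) (inj₁ p) = inj₁ p
  both (inj₂ q) (inj₂ u) = inj₂ (q , u)

  swap : {P W U : Set} → (P ⊎ W) ⊎ U → (P ⊎ U) ⊎ W
  swap (inj₁ (inj₁ p)) = inj₁ (inj₁ p)
  swap (inj₁ (inj₂ q)) = inj₂ q
  swap (inj₂ u)        = inj₁ (inj₂ u)

-- Intersection lemma (Coquand's proof of Ramsey's theorem): the three
-- versions, for A and B of arity 0, 1 and 2, each reduce to the previous one.
merge₀ : {A B : Set} → AlmostFull Q → AlmostFull T →
         (∀ {x y} → Q x y → C x y ⊎ A) → (∀ {x y} → T x y → C x y ⊎ B) →
         AlmostFull (λ x y → C x y ⊎ A × B)
merge₀ (full r) q f g = almostFull-map (λ t → both (f (r _ _)) (g t)) q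
merge₀ {C = C} (next r) q f g = next λ x → almostFull-map
  [ Sum.map inj₁ inj₁ , inj₁ ∘ inj₂ ]′
  (merge₀ {C = λ y z → C y z ⊎ C x y} (r x) q
    [ Sum.map₁ inj₁ ∘ f , Sum.map₁ inj₂ ∘ f ]′
    (Sum.map₁ inj₁ ∘ g))

merge₁ : {A B : Pred X 0ℓ} → AlmostFull Q → AlmostFull T →
         (∀ {x y} → Q x y → C x y ⊎ A x) → (∀ {x y} → T x y → C x y ⊎ B x) →
         AlmostFull (λ x y → C x y ⊎ A x × B x)
merge₁ (full r) q f g = almostFull-map (λ t → both (f (r _ _)) (g t)) q
merge₁ p@(next _) (full t) f g = almostFull-map (λ r → both (f r) (g (t _ _))) p
merge₁ {C = C} {A = A} {B} p@(next r) q@(next t) f g = next λ x →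
  -- Once `x` is drawn, `A x` and `B x` are constants. One recursive call descends in the left tree
  -- with `A x` added to `C`, the other in the right tree with `B x` added; `merge₀` joins the
  -- constants into `A x × B x`.
  almostFull-map
    [ [ Sum.map inj₁ inj₁ , inj₁ ∘ inj₂ ]′ , inj₂ ∘ inj₂ ]′
    (merge₀ {C = λ y z → (C y z ⊎ C x y) ⊎ A y × B y} {A = A x} {B x}
      (merge₁ {C = λ y z → (C y z ⊎ C x y) ⊎ A x} {A = A} {B} (r x) q
        [ Sum.map₁ (inj₁ ∘ inj₁) ∘ f , inj₁ ∘ Sum.map₁ inj₂ ∘ f ]′
        (Sum.map₁ (inj₁ ∘ inj₁) ∘ g))
      (merge₁ {C = λ y z → (C y z ⊎ C x y) ⊎ B x} {A = A} {B} p (t x)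
        (Sum.map₁ (inj₁ ∘ inj₁) ∘ f)
        [ Sum.map₁ (inj₁ ∘ inj₁) ∘ g , inj₁ ∘ Sum.map₁ inj₂ ∘ g ]′)
      swap swap)

merge₂ : {A B : Rel X 0ℓ} → AlmostFull Q → AlmostFull T →
         (∀ {x y} → Q x y → C x y ⊎ A x y) → (∀ {x y} → T x y → C x y ⊎ B x y) →
         AlmostFull (λ x y → C x y ⊎ A x y × B x y)
merge₂ (full r) q f g = almostFull-map (λ t → both (f (r _ _)) (g t)) q
merge₂ p@(next _) (full t) f g = almostFull-map (λ r → both (f r) (g (t _ _))) p
merge₂ {C = C} {A = A} {B} p@(next r) q@(next t) f g = next λ x →
  -- Here `A x` and `B x` still depend on the first of the two later entries, so the recursive
  -- results are joined by `merge₁`.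
  almostFull-map
    [ [ Sum.map inj₁ inj₁ , inj₁ ∘ inj₂ ]′ , inj₂ ∘ inj₂ ]′
    (merge₁ {C = λ y z → (C y z ⊎ C x y) ⊎ A y z × B y z} {A = A x} {B x}
      (merge₂ {C = λ y z → (C y z ⊎ C x y) ⊎ A x y} {A = A} {B} (r x) q
        [ Sum.map₁ (inj₁ ∘ inj₁) ∘ f , inj₁ ∘ Sum.map₁ inj₂ ∘ f ]′
        (Sum.map₁ (inj₁ ∘ inj₁) ∘ g))
      (merge₂ {C = λ y z → (C y z ⊎ C x y) ⊎ B x y} {A = A} {B} p (t x)
        (Sum.map₁ (inj₁ ∘ inj₁) ∘ f)
        [ Sum.map₁ (inj₁ ∘ inj₁) ∘ g , inj₁ ∘ Sum.map₁ inj₂ ∘ g ]′)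
      swap swap)

almostFull-∩ : AlmostFull Q → AlmostFull T → AlmostFull (λ x y → Q x y × T x y)
almostFull-∩ p q =
  almostFull-map [ (λ ()) , id ]′ (merge₂ {C = λ _ _ → ⊥} p q inj₂ inj₂)

almostFull-∀ : ∀ {n} {Q : Fin n → Rel X 0ℓ} → (∀ i → AlmostFull (Q i)) →
               AlmostFull (λ x y → ∀ i → Q i x y)
almostFull-∀ {n = zero}  p = full λ _ _ ()
almostFull-∀ {n = suc n} p =
  almostFull-map (λ { (r , rs) zero → r ; (r , rs) (suc i) → rs i })
    (almostFull-∩ (p zero) (almostFull-∀ (p ∘ suc)))

-- Bottom elements, bars and Dickson's lemma

open Infimum using (_≤₋_; ⊥₋≤_; [_])

-- Drawing `⊥₋` closes a branch at once, since it lies below whatever follows; only proper entries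
-- consume the given tree. Even a full relation needs one more move, because a proper entry is not
-- below `⊥₋`.
almostFull-₋ : AlmostFull Q → AlmostFull (_≤₋_ Q)
almostFull-₋ (full p) = next λ where
  ⊥₋    → full λ y z → inj₂ (⊥₋≤ y)
  [ x ] → full λ where
    ⊥₋    z → inj₁ (⊥₋≤ z)
    [ y ] z → inj₂ [ p x y ]
almostFull-₋ {Q = Q} (next p) = next λ where
    ⊥₋    → full λ y z → inj₂ (⊥₋≤ y)
    [ x ] → almostFull-map (below x) (almostFull-₋ (p x))
  where
  below : ∀ x {y z} → _≤₋_ (λ y z → Q y z ⊎ Q x y) y z →
          _≤₋_ Q y z ⊎ _≤₋_ Q [ x ] y
  below x (⊥₋≤ z)    = inj₁ (⊥₋≤ z)
  below x [ inj₁ r ] = inj₁ [ r ]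
  below x [ inj₂ r ] = inj₂ [ r ]

-- Generalised over the entries `xs` already drawn so that induction on the bar goes through: the
-- extra disjuncts say that `y` makes `xs` good, or that `xs` is good already. Both are impossible
-- for the empty sequence.
barred⇒almostFull : ∀ {xs} → Barred Q xs →
                    AlmostFull (λ y z → Q y z ⊎ Any (λ x → Q x y) xs ⊎ Good Q xs)
barred⇒almostFull (good g)   = full λ _ _ → inj₂ (inj₂ g)
barred⇒almostFull {Q = Q} (extend h) = next λ x →
  almostFull-map shift (barred⇒almostFull (h x))
  where
  shift : ∀ {x y z xs} → Q y z ⊎ Any (λ w → Q w y) (x ∷ xs) ⊎ Good Q (x ∷ xs) →
          (Q y z ⊎ Any (λ w → Q w y) xs ⊎ Good Q xs) ⊎
          (Q x y ⊎ Any (λ w → Q w x) xs ⊎ Good Q xs)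
  shift (inj₁ r)                    = inj₁ (inj₁ r)
  shift (inj₂ (inj₁ (here r)))      = inj₂ (inj₁ r)
  shift (inj₂ (inj₁ (there a)))     = inj₁ (inj₂ (inj₁ a))
  shift (inj₂ (inj₂ (now a)))       = inj₂ (inj₂ (inj₁ a))
  shift (inj₂ (inj₂ (earlier g)))   = inj₁ (inj₂ (inj₂ g))

almostFull⇒barred : ∀ {xs} → AlmostFull T →
                    (∀ {y z} → T y z → Q y z ⊎ Any (λ x → Q x y) xs ⊎ Good Q xs) →
                    Barred Q xs
almostFull⇒barred {T = T} {Q = Q} {xs} (full t) f =
  -- A full relation speaks of pairs only, so two fresh entries are drawn before the sequence is
  -- known to be good.
  extend λ x → extend λ y → good (two (f (t x y)))
  where
  two : ∀ {x y} → Q x y ⊎ Any (λ w → Q w x) xs ⊎ Good Q xs → Good Q (y ∷ x ∷ xs)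
  two (inj₁ r)        = now (here r)
  two (inj₂ (inj₁ a)) = earlier (now a)
  two (inj₂ (inj₂ g)) = earlier (earlier g)
almostFull⇒barred {T = T} {Q = Q} {xs} (next p) f =
  extend λ x → almostFull⇒barred (p x) (unshift x)
  where
  unshift : ∀ x {y z} → T y z ⊎ T x y →
            Q y z ⊎ Any (λ w → Q w y) (x ∷ xs) ⊎ Good Q (x ∷ xs)
  unshift x (inj₁ t) = Sum.map₂ (Sum.map there earlier) (f t)
  unshift x (inj₂ t) with f t
  ... | inj₁ r        = inj₂ (inj₁ (here r))
  ... | inj₂ (inj₁ a) = inj₂ (inj₂ (now a))
  ... | inj₂ (inj₂ g) = inj₂ (inj₂ (earlier g))

Pointwise₋ : ∀ {n} → Rel X 0ℓ → Rel (Fin n → X ₋) 0ℓ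
Pointwise₋ Q C D = ∀ v → _≤₋_ Q (C v) (D v)

-- Dickson's lemma: the product order is the intersection of the pullbacks of its factors along the
-- coordinates, and almost-full relations are closed under both operations.
barred-pointwise₋ : ∀ {n} → Barred Q [] → Barred (Pointwise₋ {n = n} Q) []
barred-pointwise₋ b =
  almostFull⇒barred
    (almostFull-∀ λ v → almostFull-on (λ C → C v) (almostFull-₋
      (almostFull-map [ id , [ (λ ()) , (λ ()) ]′ ]′ (barred⇒almostFull b))))
    inj₁

-- Termination of backward saturation

bad-∷ : ∀ {x xs} → ¬ Good Q xs → ¬ Any (λ y → Q y x) xs → ¬ Good Q (x ∷ xs)
bad-∷ ¬g ¬a (now a)     = ¬a a
bad-∷ ¬g ¬a (earlier g) = ¬g g

-- The bad sequence built so far is itself the current basis of the backward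
-- reachability algorithm, so that the bar bounds the number of iterations.
saturate : {_≤_ : Rel X 0ℓ} → Decidable _≤_ → {P : Pred X 0ℓ} (f : List X → List X) →
           (∀ {B} → All P B → All P (f B)) →
           ∀ {B} → Barred _≤_ B → ¬ Good _≤_ B → All P B →
           ∃ λ B′ → All P B′ × All (λ x → Any (_≤ x) B′) (f B′)
saturate _≤?_ f f-P (good g) ¬g ps = contradiction g ¬g
saturate _≤?_ f f-P {B} (extend h) ¬g ps
  with All.all? (λ x → Any.any? (_≤? x) B) (f B)
... | yes closed  = B , ps , closed
... | no ¬closed
  -- An element of `f B` above nothing in `B` keeps the sequence bad, so adding it descends one
  -- level in the bar.
  with x , x∈ , ¬a ← find (¬All⇒Any¬ (λ x → Any.any? (_≤? x) B) _ ¬closed) =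
  saturate _≤?_ f f-P (h x) (bad-∷ ¬g ¬a) (All.lookup (f-P ps) x∈ ∷ ps)

-- Finite products of lists

choices : ∀ {n} → (Fin n → List X) → List (Fin n → X)
choices {n = zero}  f = F.[] ∷ []
choices {n = suc n} f = cartesianProductWith F._∷_ (f zero) (choices (f ∘ suc))

choices⁺ : ∀ {n} {P : Fin n → Pred X 0ℓ} {f : Fin n → List X} →
           (∀ i → Any (P i) (f i)) → Any (λ c → ∀ i → P i (c i)) (choices f)
choices⁺ {n = zero}  a = here λ ()
choices⁺ {n = suc n} a =
  Any.cartesianProductWith⁺ F._∷_ (λ { p q zero → p ; p q (suc i) → q i })
    (a zero) (choices⁺ (a ∘ suc))

choices⁻ : ∀ {n} {P : Fin n → Pred X 0ℓ} {f : Fin n → List X} →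
           Any (λ c → ∀ i → P i (c i)) (choices f) → ∀ i → Any (P i) (f i)
choices⁻ {n = suc n} {P} {f} a = λ where
    zero    → proj₁ parts
    (suc i) → choices⁻ {P = P ∘ suc} (proj₂ parts) i
  where
  split : ∀ {x c} → (∀ i → P i ((x F.∷ c) i)) → P zero x × (∀ i → P (suc i) (c i))
  split p = p zero , p ∘ suc

  parts : Any (P zero) (f zero) × Any (λ c → ∀ i → P (suc i) (c i)) (choices (f ∘ suc))
  parts = Any.cartesianProductWith⁻ F._∷_ split (f zero) (choices (f ∘ suc)) a

-- Predecessor bases for states and local constraints

module Coverability {σ : ℕ} (TS : Process σ) (eff : Effective TS) where
  open Process TS
  open Effective eff
  open Network TS
  open IsPreorder (IsWellQuasiOrder.isPreorder isWellQuasiOrder)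
    renaming (refl to ≼-refl; trans to ≼-trans) using ()

  open Infimum _≼_ using () renaming (_≤₋_ to _≼₋_)

  -- A strictly descending sequence is bad, so the bar ends the descent. As `P` need not be
  -- decidable, the next smaller element cannot be searched for, and only a double negation results.
  ¬¬-minimal-below : ∀ {P : Pred S 0ℓ} {s} → P s → ¬ (∀ t → IsMinimal P t → ¬ t ≼ s)
  ¬¬-minimal-below {P} = descend (IsWellQuasiOrder.barred isWellQuasiOrder) (λ ()) []
    where
    descend : ∀ {xs} → Barred _≼_ xs → ¬ Good _≼_ xs →
              ∀ {s} → All (λ x → ¬ x ≼ s) xs → P s → ¬ (∀ t → IsMinimal P t → ¬ t ≼ s)
    descend (good g)   ¬g _   _  _    = ¬g g
    descend (extend h) ¬g {s} x⋠s Ps none = none s (Ps , minimal) ≼-refl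
      where
      minimal : ∀ t → P t → t ≼ s → s ≼ t
      -- If `s` were not below `t`, then `t` would prolong the descent: an earlier entry below `t`
      -- would also be below `s`.
      minimal t Pt t≼s = decidable-stable (s ≼? t) λ s⋠t →
        descend (h s) (bad-∷ ¬g (All¬⇒¬Any x⋠s))
          (s⋠t ∷ All.map (λ x⋠s x≼t → x⋠s (≼-trans x≼t t≼s)) x⋠s) Pt
          (λ u u-min u≼t → none u u-min (≼-trans u≼t t≼s))

  infix 4 _≟ˡ_
  _≟ˡ_ : DecidableEquality (Label (Fin σ))
  (!! a) ≟ˡ (!! b) = map′ (cong !!_) (λ { refl → refl }) (a ≟ b)
  (!! a) ≟ˡ (?? b) = no λ ()
  (?? a) ≟ˡ (!! b) = no λ ()
  (?? a) ≟ˡ (?? b) = map′ (cong ??_) (λ { refl → refl }) (a ≟ b)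

  enabling : Label (Fin σ) → List S
  enabling l = concatMap (proj₁ ∘ minimalEnabling)
    (filter (λ r → ruleLabel r ≟ˡ l) (allFin #rules))

  enabling⁺ : ∀ {l s t} → R s l t → Any (_≼ s) (enabling l)
  enabling⁺ {l} {s} {t} s→t with r , refl , fires ← to (induced s l t) s→t =
    Any.concatMap⁺ _ (lose (∈-filter⁺ (λ r → ruleLabel r ≟ˡ l) (∈-allFin r) refl)
      -- Being above an entry of a finite list is decidable, which removes the double negation.
      (decidable-stable (Any.any? (_≼? s) M) λ ¬a →
        ¬¬-minimal-below (t , fires) λ u u-min u≼s →
          ¬a (Any.map (λ m≼u → ≼-trans m≼u u≼s)
                      (proj₂ (proj₂ (minimalEnabling r)) u u-min))))
    where
    M = proj₁ (minimalEnabling r)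

  -- Compatibility lifts the transition of the minimal state `m` to `s`. It concerns `R` and not
  -- single rules, so the rule that moves `s` may be another one with the same label.
  enabling⁻ : ∀ {l s} → Any (_≼ s) (enabling l) → ∃ (R s l)
  enabling⁻ {l} a
    with r , r∈ , a′ ← find (Any.concatMap⁻ (proj₁ ∘ minimalEnabling) a)
    with m , m∈ , m≼s ← find a′
    with (t , fires) , _ ← All.lookup (proj₁ (proj₂ (minimalEnabling r))) m∈
    with u , _ , s→u ← compatible m≼s (from (induced m l t)
           (r , proj₂ (∈-filter⁻ (λ r → ruleLabel r ≟ˡ l) {xs = allFin #rules} r∈)
              , fires)) =
    u , s→u

  -- The constraint ⊥₋ is satisfied by every state: S itself need not have a
  -- computable basis.
  preState : Label (Fin σ) → S ₋ → List S
  preState l ⊥₋    = enabling l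
  preState l [ s ] = proj₁ (preBasis l (s ∷ []))

  preState⁺ : ∀ {l s t} c → R s l t → c ≼₋ [ t ] → Any (_≼ s) (preState l c)
  preState⁺ ⊥₋    s→t _     = enabling⁺ s→t
  preState⁺ [ c ] s→t [ p ] = to (proj₂ (preBasis _ _) _) (_ , s→t , here p)

  preState⁻ : ∀ {l s} c → Any (_≼ s) (preState l c) → ∃ λ t → R s l t × c ≼₋ [ t ]
  preState⁻ ⊥₋    a = map₂ (λ r → r , ⊥₋≤ _) (enabling⁻ a)
  preState⁻ [ c ] a with from (proj₂ (preBasis _ _) _) a
  ... | t , s→t , here p = t , s→t , [ p ]

  -- nothing stands for a process that does not take part in the broadcast.
  Local : Maybe (Label (Fin σ)) → Rel S 0ℓ
  Local nothing  s t = t ≡ s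
  Local (just l) s t = R s l t

  preLocal : Maybe (Label (Fin σ)) → S ₋ → List (S ₋)
  preLocal nothing  c = c ∷ []
  preLocal (just l) c = map [_] (preState l c)

  preLocal⁺ : ∀ m {s t} c → Local m s t → c ≼₋ [ t ] → Any (_≼₋ [ s ]) (preLocal m c)
  preLocal⁺ nothing  c refl p = here p
  preLocal⁺ (just l) c s→t  p = Any.map⁺ (Any.map [_] (preState⁺ c s→t p))

  preLocal⁻ : ∀ m {s} c → Any (_≼₋ [ s ]) (preLocal m c) → ∃ λ t → Local m s t × c ≼₋ [ t ]
  preLocal⁻ nothing  c (here p) = _ , refl , p
  preLocal⁻ (just l) c a = preState⁻ c (Any.map (λ { [ p ] → p }) (Any.map⁻ a))

  IsProper : S ₋ → Set
  IsProper c = ∃ λ s → c ≡ [ s ]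

  preLocal-proper : ∀ m {c c′} → IsProper c → c′ ∈ˡ preLocal m c → IsProper c′
  preLocal-proper nothing  proper (here refl) = proper
  preLocal-proper (just l) proper c′∈ with s , _ , eq ← ∈-map⁻ [_] c′∈ = s , eq

  Covers : S → (G : Graph) → (Graph.Vertex G → S) → Set
  Covers s G L = ∃ λ θ → ⟨ G , L ⟩ ⟶* θ × ∃ λ v → s ≼ SGraph.label θ v

  -- Backward reachability on a fixed graph

  module FixedTopology (s : S) (G : Graph) where
    open Graph G

    Constraint : Set
    Constraint = Vertex → S ₋

    infix 4 _⊑_ _⊨_
    _⊑_ : Rel Constraint 0ℓ
    _⊑_ = Pointwise₋ _≼_

    _⊑?_ : Decidable _⊑_
    C ⊑? D = all? λ v → Infimum.≤₋-dec _≼_ _≼?_ (C v) (D v)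

    ⊑-trans : Transitive _⊑_
    ⊑-trans p q v = Infimum.≤₋-trans _≼_ ≼-trans (p v) (q v)

    _⊨_ : (Vertex → S) → Constraint → Set
    L ⊨ C = C ⊑ [_] ∘ L

    -- Splits a broadcast into one independent condition per vertex, so that predecessor constraints
    -- form a finite product of local ones.
    role : Vertex → Fin σ → Vertex → Maybe (Label (Fin σ))
    role v a u with u ≟ v | u ∈? neighbours v
    ... | yes _ | _     = just (!! a)
    ... | no _  | yes _ = just (?? a)
    ... | no _  | no _  = nothing

    Step : Vertex → Fin σ → Rel (Vertex → S) 0ℓ
    Step v a L L′ = ∀ u → Local (role v a u) (L u) (L′ u)

    step⇒⟶ : ∀ {v a L L′} → Step v a L L′ → ⟨ G , L ⟩ ⟶[ a ] ⟨ G , L′ ⟩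
    step⇒⟶ {v} {a} {L} {L′} st = broadcast v sends receives idle
      where
      sends : R (L v) (!! a) (L′ v)
      sends with v ≟ v | v ∈? neighbours v | st v
      ... | yes _  | _ | r = r
      ... | no v≢v | _ | _ = contradiction refl v≢v

      receives : ∀ u → u ∈ neighbours v → R (L u) (?? a) (L′ u)
      receives u u∈ with u ≟ v | u ∈? neighbours v | st u
      ... | yes refl | _      | _ = contradiction u∈ (irreflexive v)
      ... | no _     | yes _  | r = r
      ... | no _     | no u∉  | _ = contradiction u∈ u∉

      idle : ∀ u → u ≢ v → u ∉ neighbours v → L′ u ≡ L u
      idle u u≢v u∉ with u ≟ v | u ∈? neighbours v | st u
      ... | yes u≡v | _      | _ = contradiction u≡v u≢v
      ... | no _    | yes u∈ | _ = contradiction u∈ u∉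
      ... | no _    | no _   | r = r

    broadcast⇒step : ∀ {v a L L′} → R (L v) (!! a) (L′ v) →
      (∀ u → u ∈ neighbours v → R (L u) (?? a) (L′ u)) →
      (∀ u → u ≢ v → u ∉ neighbours v → L′ u ≡ L u) → Step v a L L′
    broadcast⇒step {v} sends receives idle u with u ≟ v | u ∈? neighbours v
    ... | yes refl | _      = sends
    ... | no _     | yes u∈ = receives u u∈
    ... | no u≢v   | no u∉  = idle u u≢v u∉

    preVia : Constraint → Vertex × Fin σ → List Constraint
    preVia C (v , a) = choices λ u → preLocal (role v a u) (C u)

    moves : List (Vertex × Fin σ)
    moves = cartesianProduct (allFin order) (allFin σ)

    pre : Constraint → List Constraint
    pre C = concatMap (preVia C) moves

    pre⁺ : ∀ {C v a L L′} → Step v a L L′ → L′ ⊨ C → Any (L ⊨_) (pre C)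
    pre⁺ {C} {v} {a} st L′⊨C = Any.concatMap⁺ (preVia C)
      (lose (∈-cartesianProduct⁺ (∈-allFin v) (∈-allFin a))
        (choices⁺ λ u → preLocal⁺ (role v a u) (C u) (st u) (L′⊨C u)))

    pre⁻ : ∀ {C L} → Any (L ⊨_) (pre C) → ∃₂ λ v a → ∃ λ L′ → Step v a L L′ × L′ ⊨ C
    pre⁻ {C} {L} p with (v , a) , _ , q ← find (Any.concatMap⁻ (preVia C) {xs = moves} p) =
      -- The successor labelling is assembled from choices made separately at each vertex.
      v , a , proj₁ ∘ back , proj₁ ∘ proj₂ ∘ back , proj₂ ∘ proj₂ ∘ back
      where
      back : ∀ u → ∃ λ t → Local (role v a u) (L u) t × C u ≼₋ [ t ]
      back u = preLocal⁻ (role v a u) (C u) (choices⁻ {P = λ u → _≼₋ [ L u ]} q u)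

    HasProper : Constraint → Set
    HasProper C = ∃ λ v → IsProper (C v)

    pre-proper : ∀ {C D} → HasProper C → D ∈ˡ pre C → HasProper D
    pre-proper {C} {D} (u , proper) D∈
      with (v , a) , _ , D∈′ ← find (Any.concatMap⁻ (preVia C) {xs = moves} D∈) =
      u , preLocal-proper (role v a u) proper
            -- Membership in `choices` is weakened to coordinatewise equality, the form to which
            -- `choices⁻` applies.
            (choices⁻ {P = λ u → D u ≡_} (Any.map (λ { refl _ → refl }) D∈′) u)

    target : Vertex → Constraint
    target v u with u ≟ v
    ... | yes _ = [ s ]
    ... | no _  = ⊥₋

    target⁺ : ∀ {v L} → s ≼ L v → L ⊨ target v
    target⁺ {v} s≼Lv u with u ≟ v
    ... | yes refl = [ s≼Lv ]
    ... | no _     = ⊥₋≤ _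

    target-refl : ∀ v → target v v ≡ [ s ]
    target-refl v with v ≟ v
    ... | yes _  = refl
    ... | no v≢v = contradiction refl v≢v

    target⁻ : ∀ {v L} → L ⊨ target v → s ≼ L v
    target⁻ {v} {L} L⊨ = Infimum.[≤]-injective _≼_ (subst (_≼₋ [ L v ]) (target-refl v) (L⊨ v))

    -- The targets belong to every frontier, so saturation can start from the empty list, which is
    -- trivially bad and sound, and closedness also supplies the base case of completeness.
    frontier : List Constraint → List Constraint
    frontier B = tabulate target ++ concatMap pre B

    -- Properness of some vertex is what makes satisfiability by an initial
    -- labelling decidable: Initial itself is not known to be decidably inhabited.
    Sound : Constraint → Set
    Sound C = (∀ {L} → L ⊨ C → Covers s G L) × HasProper C

    frontier-sound : ∀ {B} → All Sound B → All Sound (frontier B)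
    frontier-sound {B} B-sound =
      All.tabulate λ D∈ → [ inTarget , inPre ]′ (Any.++⁻ (tabulate target) D∈)
      where
      inTarget : ∀ {D} → D ∈ˡ tabulate target → Sound D
      inTarget D∈ with v , refl ← Any.tabulate⁻ D∈ =
        (λ L⊨ → _ , ε , v , target⁻ L⊨) , v , s , target-refl v

      inPre : ∀ {D} → D ∈ˡ concatMap pre B → Sound D
      inPre {D} D∈ with C , C∈ , D∈C ← find (Any.concatMap⁻ pre D∈)
                   with C-covers , proper ← All.lookup B-sound C∈ =
        covers , pre-proper proper D∈C
        where
        covers : ∀ {L} → L ⊨ D → Covers s G L
        covers L⊨D with v , a , L′ , st , L′⊨C ← pre⁻ {C} (lose D∈C L⊨D)
                   with θ , steps , above ← C-covers L′⊨C =
          θ , (a , step⇒⟶ st) ◅ steps , above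

    -- Induction on the run: its last labelling satisfies a target, and each earlier one satisfies a
    -- predecessor of a constraint met by its successor. Closedness replaces either by a weaker
    -- constraint from `B`.
    frontier-complete : ∀ {B} → All (λ D → Any (_⊑ D) B) (frontier B) →
                        ∀ {L θ} → ⟨ G , L ⟩ ⟶* θ → (∃ λ v → s ≼ SGraph.label θ v) →
                        Any (L ⊨_) B
    frontier-complete {B} closed = λ where
        ε (v , s≼) → absorb (Any.++⁺ˡ (Any.tabulate⁺ v (target⁺ s≼)))
        ((a , broadcast v sends receives idle) ◅ steps) above →
          absorb (Any.++⁺ʳ (tabulate target) (Any.concatMap⁺ pre
            (Any.map (pre⁺ (broadcast⇒step sends receives idle))
                     (frontier-complete closed steps above))))
      where
      absorb : ∀ {L} → Any (L ⊨_) (frontier B) → Any (L ⊨_) B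
      absorb a with D , D∈ , L⊨D ← find a =
        Any.map (λ C⊑D → ⊑-trans C⊑D L⊨D) (All.lookup closed D∈)

    satisfiable? : ∀ {C} → HasProper C → Dec (∃ λ L → (∀ v → Initial (L v)) × L ⊨ C)
    satisfiable? {C} (v₀ , x , eq) with initial? x
    ... | no ¬i = no λ (L , init , L⊨C) →
      ¬i (L v₀ , init v₀ , Infimum.[≤]-injective _≼_ (subst (_≼₋ [ L v₀ ]) eq (L⊨C v₀)))
    ... | yes (s₀ , s₀-init , _) =
      map′ (λ f → proj₁ ∘ f , proj₁ ∘ proj₂ ∘ f , proj₂ ∘ proj₂ ∘ f)
           (λ (L , init , L⊨C) v → L v , init v , L⊨C v)
           (all? λ v → at (C v))
      where
      at : ∀ c → Dec (∃ λ t → Initial t × c ≼₋ [ t ])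
      -- A free vertex takes the initial state returned by the query at the proper vertex.
      at ⊥₋    = yes (s₀ , s₀-init , ⊥₋≤ _)
      at [ c ] = map′ (map₂ (map₂ [_])) (map₂ (map₂ (Infimum.[≤]-injective _≼_)))
                      (initial? c)

    covers? : Dec (∃ λ L → (∀ v → Initial (L v)) × Covers s G L)
    covers? with B , sound , closed ← saturate _⊑?_ frontier frontier-sound
                   (barred-pointwise₋ (IsWellQuasiOrder.barred isWellQuasiOrder)) (λ ()) [] =
      map′ forth back (decideAny sound)
      where
      InitialSat : Constraint → Set
      InitialSat C = ∃ λ L → (∀ v → Initial (L v)) × L ⊨ C

      decideAny : ∀ {B} → All Sound B → Dec (Any InitialSat B)
      decideAny []                  = no λ ()
      decideAny ((_ , proper) ∷ ss) = map′ Any.fromSum Any.toSum (satisfiable? proper ⊎-dec decideAny ss)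

      forth : Any InitialSat B → ∃ λ L → (∀ v → Initial (L v)) × Covers s G L
      forth a with C , C∈ , L , init , L⊨C ← find a =
        L , init , proj₁ (All.lookup sound C∈) L⊨C

      back : (∃ λ L → (∀ v → Initial (L v)) × Covers s G L) → Any InitialSat B
      back (L , init , θ , steps , above) =
        Any.map (λ L⊨C → L , init , L⊨C) (frontier-complete closed steps above)

-- The Moore bound

elements : ∀ {n} → Subset n → List (Fin n)
elements []            = []
elements (inside ∷ p)  = zero ∷ map suc (elements p)
elements (outside ∷ p) = map suc (elements p)

length-elements : ∀ {n} (p : Subset n) → length (elements p) ≡ ∣ p ∣
length-elements []            = refl
length-elements (inside ∷ p)  = cong suc (trans (length-map suc (elements p)) (length-elements p))
length-elements (outside ∷ p) = trans (length-map suc (elements p)) (length-elements p)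

∈-elements : ∀ {n} {p : Subset n} {v} → v ∈ p → v ∈ˡ elements p
∈-elements {p = inside ∷ p}  here       = here refl
∈-elements {p = inside ∷ p}  (there v∈) = there (∈-map⁺ suc (∈-elements v∈))
∈-elements {p = outside ∷ p} (there v∈) = ∈-map⁺ suc (∈-elements v∈)

length-concatMap-≤ : ∀ {f : X → List Y} {b} → (∀ x → length (f x) ≤ b) →
                     ∀ xs → length (concatMap f xs) ≤ length xs * b
length-concatMap-≤ f≤b []       = z≤n
length-concatMap-≤ {f = f} f≤b (x ∷ xs) =
  ≤-trans (≤-reflexive (length-++ (f x))) (+-mono-≤ (f≤b x) (length-concatMap-≤ f≤b xs))

-- The position at which a vertex is found determines the vertex, so `Fin n` injects into the
-- positions of the list.
covering⇒≤length : ∀ {n} (vs : List (Fin n)) → (∀ v → v ∈ˡ vs) → n ≤ length vs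
covering⇒≤length vs all∈ = injective⇒≤ {f = Any.index ∘ all∈} λ {u} {v} eq →
  trans (lookup-index (all∈ u)) (trans (cong (lookup vs) eq) (sym (lookup-index (all∈ v))))

-- The sum 1 + d + ... + d^k. It allows `d` continuations at every level, since the walks counted
-- may turn back.
mooreBound : ℕ → ℕ → ℕ
mooreBound zero    d = 1
mooreBound (suc k) d = suc (d * mooreBound k d)

module _ (G : Graph) where
  open Graph G

  ball : ℕ → Vertex → List Vertex
  ball zero    u = u ∷ []
  ball (suc k) u = u ∷ concatMap (ball k) (elements (neighbours u))

  walk⇒∈ball : ∀ {m k u v} → m ≤ k → Walk m u v → v ∈ˡ ball k u
  walk⇒∈ball {k = zero}  z≤n       stop        = here refl
  walk⇒∈ball {k = suc k} z≤n       stop        = here refl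
  walk⇒∈ball {k = suc k} (s≤s m≤k) (step v∈ w) =
    there (Any.concatMap⁺ (ball k) (lose (∈-elements v∈) (walk⇒∈ball m≤k w)))

  length-ball : ∀ {d} → MaxDegree≤ d G → ∀ k u → length (ball k u) ≤ mooreBound k d
  length-ball deg zero    u = s≤s z≤n
  length-ball {d} deg (suc k) u = s≤s (begin
    length (concatMap (ball k) (elements (neighbours u)))
      ≤⟨ length-concatMap-≤ (length-ball deg k) (elements (neighbours u)) ⟩
    length (elements (neighbours u)) * mooreBound k d
      ≡⟨ cong (_* mooreBound k d) (length-elements (neighbours u)) ⟩
    degree u * mooreBound k d
      ≤⟨ *-monoˡ-≤ (mooreBound k d) (deg u) ⟩
    d * mooreBound k d ∎)
    where open ≤-Reasoning

  order≤mooreBound : ∀ {k d} → Diameter≤ k G → MaxDegree≤ d G → Vertex → order ≤ mooreBound k d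
  order≤mooreBound {k} diam deg u =
    ≤-trans (covering⇒≤length (ball k u) u-reaches) (length-ball deg k u)
    where
    u-reaches : ∀ v → v ∈ˡ ball k u
    u-reaches v = let m , m≤k , w = diam u v in walk⇒∈ball m≤k w

  -- Decidability of the diameter and degree conditions

  walk? : ∀ m u v → Dec (Walk m u v)
  walk? zero    u v = map′ (λ { refl → stop }) (λ { stop → refl }) (u ≟ v)
  walk? (suc m) u w = map′ (λ (v , v∈ , vw) → step v∈ vw) (λ { (step v∈ vw) → _ , v∈ , vw })
                           (any? λ v → v ∈? neighbours u ×-dec walk? m v w)

  diameter≤? : ∀ k → Dec (Diameter≤ k G)
  diameter≤? k = all? λ u → all? λ v →
    -- `anyUpTo?` searches strictly below its bound, hence the shift by one.
    map′ (map₂ λ (m<1+k , w) → s≤s⁻¹ m<1+k , w) (map₂ λ (m≤k , w) → s≤s m≤k , w)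
         (anyUpTo? (λ m → walk? m u v) (suc k))

  maxDegree≤? : ∀ d → Dec (MaxDegree≤ d G)
  maxDegree≤? d = all? λ v → degree v ≤? d

-- Exhaustive search over neighbourhood functions

-- There is no function extensionality, so the search is exhaustive only for
-- properties that respect pointwise equality.
anyFunction? : (∀ {P : Pred X 0ℓ} → Unary.Decidable P → Dec (∃ P)) →
               ∀ {n} {P : Pred (Fin n → X) 0ℓ} →
               (∀ {f g} → f ≗ g → P f → P g) → Unary.Decidable P → Dec (∃ P)
anyFunction? search {zero}  resp P? =
  map′ (λ p → F.[] , p) (λ (f , p) → resp (λ ()) p) (P? F.[])
anyFunction? search {suc n} resp P? =
  map′ (λ (x , f , p) → x F.∷ f , p)
       (λ (f , p) → f zero , f ∘ suc , resp (λ { zero → refl ; (suc i) → refl }) p)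
       (search λ x → anyFunction? search (λ eq → resp λ { zero → refl ; (suc i) → eq i })
                                         (λ f → P? (x F.∷ f)))

module _ {n} (N : Fin n → Subset n) where

  Symmetric Irreflexive : Set
  Symmetric   = ∀ u v → u ∈ N v → v ∈ N u
  Irreflexive = ∀ v → v ∉ N v

  symmetric? : Dec Symmetric
  symmetric? = all? λ u → all? λ v → u ∈? N v →-dec v ∈? N u

  irreflexive? : Dec Irreflexive
  irreflexive? = all? λ v → ¬? (v ∈? N v)

  mkGraph : Symmetric → Irreflexive → Graph
  mkGraph s i = record { order = n ; neighbours = N ; symmetric = s ; irreflexive = i }

module _ {n} {M N : Fin n → Subset n} (M≗N : M ≗ N)
         {s : Symmetric M} {i : Irreflexive M} {s′ : Symmetric N} {i′ : Irreflexive N} where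

  private
    G = mkGraph M s i
    H = mkGraph N s′ i′

    M⊆N : ∀ {u v} → u ∈ M v → u ∈ N v
    M⊆N {u} {v} = subst (u ∈_) (M≗N v)

    N⊆M : ∀ {u v} → u ∈ N v → u ∈ M v
    N⊆M {u} {v} = subst (u ∈_) (sym (M≗N v))

  walk-resp : ∀ {m u v} → Graph.Walk G m u v → Graph.Walk H m u v
  walk-resp Graph.stop        = Graph.stop
  walk-resp (Graph.step v∈ w) = Graph.step (M⊆N v∈) (walk-resp w)

  diameter-resp : ∀ {k} → Diameter≤ k G → Diameter≤ k H
  diameter-resp diam u v = map₂ (map₂ walk-resp) (diam u v)

  maxDegree-resp : ∀ {d} → MaxDegree≤ d G → MaxDegree≤ d H
  maxDegree-resp {d} deg v = subst (λ p → ∣ p ∣ ≤ d) (M≗N v) (deg v)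

  module _ {σ} (TS : Process σ) (eff : Effective TS) where
    open Network TS
    open Coverability TS eff using (Covers)

    -- The same senders and labellings replay the run on `H`: receivers transfer by `N⊆M`,
    -- bystanders by `M⊆N`.
    covers-resp : ∀ {c L θ} → ⟨ G , L ⟩ ⟶* θ →
                  (∃ λ v → Process._≼_ TS c (SGraph.label θ v)) → Covers c H L
    covers-resp ε above = _ , ε , above
    covers-resp ((a , broadcast v sends receives idle) ◅ steps) above =
      let θ , steps′ , above′ = covers-resp steps above in
      θ , (a , broadcast v sends (λ u u∈ → receives u (N⊆M u∈))
                                 (λ u u≢v u∉ → idle u u≢v (u∉ ∘ M⊆N))) ◅ steps′ , above′

-- Search over all graphs within the Moore bound

theorem22 : ∀ {σ : ℕ} (TS : Process σ) → Effective TS →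
    (k d : ℕ) (s : Process.S TS) →
    Dec (Network.Coverable TS k d s)
theorem22 TS eff k d s = map′ forth back
  (anyUpTo? (λ n → anyFunction? anySubset? (resp {n}) coverableBy?) (suc (mooreBound k d)))
  where
  open Process TS
  open Network TS
  open Coverability TS eff using (Covers; module FixedTopology)

  CoverableOn : Graph → Set
  CoverableOn G = Diameter≤ k G × MaxDegree≤ d G × ∃ λ L → (∀ v → Initial (L v)) × Covers s G L

  coverableOn? : Unary.Decidable CoverableOn
  coverableOn? G = diameter≤? G k ×-dec maxDegree≤? G d ×-dec FixedTopology.covers? s G

  coverableOn-resp : ∀ {n} {M N : Fin n → Subset n} {sM iM} sN iN → M ≗ N →
                     CoverableOn (mkGraph M sM iM) → CoverableOn (mkGraph N sN iN)
  coverableOn-resp {sM = sM} {iM} sN iN eq (diam , deg , L , init , _ , steps , above) =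
    diameter-resp eq diam , maxDegree-resp eq {sM} {iM} {sN} {iN} deg ,
    L , init , covers-resp eq TS eff steps above

  CoverableBy : ∀ {n} → Pred (Fin n → Subset n) 0ℓ
  CoverableBy N = ∃₂ λ sN iN → CoverableOn (mkGraph N sN iN)

  resp : ∀ {n} {M N : Fin n → Subset n} → M ≗ N → CoverableBy M → CoverableBy N
  resp {M = M} {N} eq (sM , iM , c) = sN , iN , coverableOn-resp sN iN eq c
    where
    sN : Symmetric N
    sN u v u∈ = subst (v ∈_) (eq u) (sM u v (subst (u ∈_) (sym (eq v)) u∈))

    iN : Irreflexive N
    iN v v∈ = iM v (subst (v ∈_) (sym (eq v)) v∈)

  coverableBy? : ∀ {n} → Unary.Decidable (CoverableBy {n})
  coverableBy? N with symmetric? N | irreflexive? N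
  ... | no ¬sN | _      = no λ (sN , _) → ¬sN sN
  ... | yes _  | no ¬iN = no λ (_ , iN , _) → ¬iN iN
  ... | yes sN | yes iN =
    -- A given witness carries its own proofs of symmetry and irreflexivity; transport along `refl`
    -- exchanges them for `sN` and `iN`.
    map′ (λ c → sN , iN , c) (λ (_ , _ , c) → coverableOn-resp sN iN (λ _ → refl) c)
         (coverableOn? (mkGraph N sN iN))

  forth : (∃ λ n → n < suc (mooreBound k d) × ∃ λ N → CoverableBy {n} N) → Coverable k d s
  forth (_ , _ , _ , _ , _ , diam , deg , L , init , θ , steps , above) =
    ⟨ _ , L ⟩ , θ , init , diam , deg , steps , above

  -- The Moore bound needs a centre for its ball, and any vertex of `θ₀` will do: the given vertex
  -- if the run is empty, otherwise the first sender.
  vertex : ∀ {θ₀ θ} → θ₀ ⟶* θ → SGraph.Vertex θ → SGraph.Vertex θ₀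
  vertex ε                            v = v
  vertex ((_ , broadcast u _ _ _) ◅ _) _ = u

  back : Coverable k d s → ∃ λ n → n < suc (mooreBound k d) × ∃ λ N → CoverableBy {n} N
  back (⟨ G , L ⟩ , θ , init , diam , deg , steps , above) =
    Graph.order G , s≤s (order≤mooreBound G diam deg (vertex steps (proj₁ above))) ,
    Graph.neighbours G , Graph.symmetric G , Graph.irreflexive G ,
    diam , deg , L , init , θ , steps , above
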